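{- Let $N\ge5$ be an integer, $m=\lfloor N/2\rfloor$, $M=N\gcd(2,N)$, and $$\Pi_N=\Bigl\{(e_1,\dots,e_m)\in\mathbb Z^m:\ \sum_{j=1}^me_j\equiv0\pmod{12},\ \sum_{j=1}^mj^2e_j\equiv0\pmod{M}\Bigr\}.$$ If $N=5$, the columns of $B_5=\begin{pmatrix}16&-5\\-4&5\end{pmatrix}$ form a $\mathbb Z$-basis of $\Pi_5$. If $N\ge6$, let $r_N\in\{0,1,2\}$ be the unique integer with $r_N\equiv2M\pmod3$, and put $a_N=\frac{ -M+5r_N}3$, $b_N=\frac{M-8r_N}3$, $$\mathbf z_1=(16,-4,0,\dots,0)^T,\qquad \mathbf z_2=(a_N,b_N,r_N,0,\dots,0)^T.$$ For each $j\in\{3,\dots,m\}$ with $3\nmid j$ let $$\mathbf w_j=\left(\tfrac{j^2-4}3,\,-\tfrac{j^2-1}3,\,0,\dots,0,1,0,\dots,0\right)^T$$ with the $1$ in the $j$-th coordinate. Let $\{j\in\{3,\dots,m\}:3\mid j\}=\{j_1<\dots<j_r\}$ (nonempty since $m\ge3$), let $$\mathbf v_0=\left(j_1^2-4,\,-(j_1^2-1),\,0,\dots,0,3,0,\dots,0\right)^T$$ with the $3$ in the $j_1$-th coordinate, and for $2\le t\le r$ let $$\mathbf v_t=\left(\tfrac{j_t^2-j_1^2}3,\,-\tfrac{j_t^2-j_1^2}3,\,0,\dots,0,-1,0,\dots,0,1,0,\dots,0\right)^T$$ with $-1$ and $1$ in the $j_1$-th and $j_t$-th coordinates, respectively. Then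 $$\mathcal B_N=\{\mathbf z_1,\mathbf z_2\}\cup\{\mathbf w_j:3\le j\le m,\ 3\nmid j\}\cup\{\mathbf v_0\}\cup\{\mathbf v_t:2\le t\le r\}$$ is a $\mathbb Z$-basis of $\Pi_N$.
   Context: All notation is introduced in the claim. -}

module Defs where

open import Data.Bool.Base using (if_then_else_)
open import Data.Fin.Base using (Fin; toℕ)
open import Data.Integer.Base using (ℤ; +_; -_; _+_; _-_; _*_; 0ℤ; 1ℤ; -[1+_])
open import Data.Integer.DivMod using (_/ℕ_)
open import Data.Integer.Divisibility.Signed using (_∣_; divides; ∣⇒∣ᵤ)
open import Data.Integer.Properties using (+-*-semiring; pos-*; pos-+; *-identityʳ; neg-distribˡ-*)
open import Data.Integer.Solver using (module +-*-Solver)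
open import Data.List.Base using (List; []; _∷_; _++_; applyUpTo; filter; length; lookup; map)
open import Data.Nat.Base as ℕ using (ℕ; suc; ⌊_/2⌋; z≤n; s≤s)
open import Data.Nat.DivMod using (_%_; m≡m%n+[m/n]*n; m%n<n; m/n*n≡m)
open import Data.Nat.Divisibility as ℕ∣ using (_∣?_; m%n≡0⇒n∣m; n∣m⇒m%n≡0)
open import Data.Nat.GCD using (gcd)
open import Data.Product.Base using (∃; _×_; _,_)
open import Data.Vec.Functional as Vector using (Vector)
open import Level using (0ℓ)
open import Relation.Binary.PropositionalEquality
  using (_≡_; _≢_; _≗_; refl; sym; trans; cong; cong₂; module ≡-Reasoning)
open import Relation.Nullary.Decidable using (¬?)
open import Relation.Nullary.Negation using (¬_; contradiction)
open import Relation.Unary using (Pred)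

open import Algebra.Properties.Semiring.Sum +-*-semiring using (sum)

linComb : ∀ {m} (bs : List (Vector ℤ m)) → Vector ℤ (length bs) → Vector ℤ m
linComb bs c i = sum (λ k → c k * lookup bs k i)

-- The vectors are a list, hence an indexed family: `independent` in particular
-- forces them to be pairwise distinct.
record IsBasis {m} (L : Pred (Vector ℤ m) 0ℓ) (bs : List (Vector ℤ m)) : Set where
  field
    members     : ∀ k → L (lookup bs k)
    independent : ∀ c → (∀ i → linComb bs c i ≡ 0ℤ) → ∀ k → c k ≡ 0ℤ
    spanning    : ∀ v → L v → ∃ λ c → linComb bs c ≗ v

M : ℕ → ℕ
M N = N ℕ.* gcd 2 N

-- The position i : Fin m carries the coordinate of index j = suc (toℕ i) ∈ {1,…,m}.
Π : (N : ℕ) → Pred (Vector ℤ ⌊ N /2⌋) 0ℓ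
Π N e = (+ 12  ∣ sum e)
      × (+ M N ∣ sum (λ i → + (suc (toℕ i) ℕ.^ 2) * e i))

B₅ : Vector (Vector ℤ 2) 2
B₅ = row (+ 16) (- + 5) Vector.∷ row (- + 4) (+ 5) Vector.∷ Vector.[]
  where
  row : ℤ → ℤ → Vector ℤ 2
  row x y = x Vector.∷ y Vector.∷ Vector.[]

columns : ∀ {m n} → Vector (Vector ℤ n) m → List (Vector ℤ m)
columns A = Vector.toList (Vector.transpose A)

-- The j-th standard unit vector, j being a 1-based index.
unit : ∀ {m} → ℕ → Vector ℤ m
unit j i = if suc (toℕ i) ℕ.≡ᵇ j then 1ℤ else 0ℤ

-- `_/ℕ 3` is floor division; the lemmas ending in `-exact` below show that
-- every use of it is an exact division.

r : ℕ → ℤ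
r N = + ((2 ℕ.* M N) % 3)

a b : ℕ → ℤ
a N = (- (+ M N) + + 5 * r N) /ℕ 3
b N = (+ M N - + 8 * r N) /ℕ 3

module _ {m : ℕ} where

  z₁ : Vector ℤ m
  z₁ i = + 16 * unit 1 i - + 4 * unit 2 i

  z₂ : ℕ → Vector ℤ m
  z₂ N i = a N * unit 1 i + b N * unit 2 i + r N * unit 3 i

  w : ℕ → Vector ℤ m
  w j i = (+ (j ℕ.^ 2) - + 4) /ℕ 3 * unit 1 i
        - (+ (j ℕ.^ 2) - + 1) /ℕ 3 * unit 2 i
        + unit j i

  v₀ : ℕ → Vector ℤ m
  v₀ j₁ i = (+ (j₁ ℕ.^ 2) - + 4) * unit 1 i
          - (+ (j₁ ℕ.^ 2) - + 1) * unit 2 i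
          + + 3 * unit j₁ i

  v : (j₁ jₜ : ℕ) → Vector ℤ m
  v j₁ jₜ i = (+ (jₜ ℕ.^ 2) - + (j₁ ℕ.^ 2)) /ℕ 3 * unit 1 i
            - (+ (jₜ ℕ.^ 2) - + (j₁ ℕ.^ 2)) /ℕ 3 * unit 2 i
            - unit j₁ i
            + unit jₜ i

-- 3 , 4 , … , m
from3To : ℕ → List ℕ
from3To m = applyUpTo (3 ℕ.+_) (m ℕ.∸ 2)

nonMultiples multiples : ℕ → List ℕ
nonMultiples m = filter (λ j → ¬? (3 ∣? j)) (from3To m)
multiples    m = filter (3 ∣?_) (from3To m)

-- The argument is j₁ < … < jᵣ; by `multiples-nonempty` it is never [] when m ≥ 3.
vs : ∀ {m} → List ℕ → List (Vector ℤ m)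
vs []        = []
vs (j₁ ∷ js) = v₀ j₁ ∷ map (v j₁) js

ℬ : (N : ℕ) → List (Vector ℤ ⌊ N /2⌋)
ℬ N = z₁ ∷ z₂ N ∷ map w (nonMultiples ⌊ N /2⌋) ++ vs (multiples ⌊ N /2⌋)

multiples-nonempty : ∀ {m} → 3 ℕ.≤ m → multiples m ≢ []
multiples-nonempty (s≤s (s≤s (s≤s z≤n))) ()

private
  open +-*-Solver

  /ℕ3-exact : ∀ x → + 3 ∣ x → x /ℕ 3 * + 3 ≡ x
  /ℕ3-exact (+ n) d = trans (sym (pos-* (n ℕ./ 3) 3)) (cong +_ (m/n*n≡m (∣⇒∣ᵤ d)))
  /ℕ3-exact -[1+ n ] d with suc n % 3 | n∣m⇒m%n≡0 (suc n) 3 (∣⇒∣ᵤ d)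
  ... | .0 | refl = begin
    - (+ (suc n ℕ./ 3)) * + 3   ≡⟨ neg-distribˡ-* (+ (suc n ℕ./ 3)) (+ 3) ⟨
    - (+ (suc n ℕ./ 3) * + 3)   ≡⟨ cong -_ (pos-* (suc n ℕ./ 3) 3) ⟨
    - (+ (suc n ℕ./ 3 ℕ.* 3))   ≡⟨ cong (λ k → - (+ k)) (m/n*n≡m (∣⇒∣ᵤ d)) ⟩
    - (+ suc n)                 ∎
    where open ≡-Reasoning

  pos-divMod : ∀ n → + n ≡ + (n % 3) + + (n ℕ./ 3) * + 3
  pos-divMod n = trans (cong +_ (m≡m%n+[m/n]*n n 3))
    (trans (pos-+ (n % 3) (n ℕ./ 3 ℕ.* 3)) (cong (λ x → + (n % 3) + x) (pos-* (n ℕ./ 3) 3)))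

  pos-sq : ∀ n → + (n ℕ.^ 2) ≡ + n * + n
  pos-sq n = trans (pos-* n (n ℕ.* 1))
    (cong (λ x → + n * x) (trans (pos-* n 1) (*-identityʳ (+ n))))

  2M≡ : ∀ N → + 2 * + M N ≡ r N + + ((2 ℕ.* M N) ℕ./ 3) * + 3
  2M≡ N = trans (sym (pos-* 2 (M N))) (pos-divMod (2 ℕ.* M N))

  r≡ : ∀ N → r N ≡ + 2 * + M N - + ((2 ℕ.* M N) ℕ./ 3) * + 3
  r≡ N = trans (lem (r N) q) (cong (λ x → x - q * + 3) (sym (2M≡ N)))
    where
    q : ℤ
    q = + ((2 ℕ.* M N) ℕ./ 3)
    lem : ∀ x y → x ≡ (x + y * + 3) - y * + 3
    lem = solve 2 (λ x y → x := (x :+ y :* con (+ 3)) :- y :* con (+ 3)) refl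

  sq-nonMultiple : ∀ j → ¬ (3 ℕ∣.∣ j) → ∃ λ q → + (j ℕ.^ 2) ≡ 1ℤ + q * + 3
  sq-nonMultiple j 3∤j with j % 3 in eq | m%n<n j 3 | pos-divMod j
  ... | 0 | _ | _ = contradiction (m%n≡0⇒n∣m j 3 eq) 3∤j
  ... | 1 | _ | p = + 3 * + (j ℕ./ 3) * + (j ℕ./ 3) + + 2 * + (j ℕ./ 3) , trans (pos-sq j) (trans (cong₂ _*_ p p) (lem (+ (j ℕ./ 3))))
    where
    lem : ∀ x → (+ 1 + x * + 3) * (+ 1 + x * + 3) ≡ 1ℤ + (+ 3 * x * x + + 2 * x) * + 3
    lem = solve 1 (λ x → (con (+ 1) :+ x :* con (+ 3)) :* (con (+ 1) :+ x :* con (+ 3))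
      := con 1ℤ :+ (con (+ 3) :* x :* x :+ con (+ 2) :* x) :* con (+ 3)) refl
  ... | 2 | _ | p = + 3 * + (j ℕ./ 3) * + (j ℕ./ 3) + + 4 * + (j ℕ./ 3) + + 1 , trans (pos-sq j) (trans (cong₂ _*_ p p) (lem (+ (j ℕ./ 3))))
    where
    lem : ∀ x → (+ 2 + x * + 3) * (+ 2 + x * + 3) ≡ 1ℤ + (+ 3 * x * x + + 4 * x + + 1) * + 3
    lem = solve 1 (λ x → (con (+ 2) :+ x :* con (+ 3)) :* (con (+ 2) :+ x :* con (+ 3))
      := con 1ℤ :+ (con (+ 3) :* x :* x :+ con (+ 4) :* x :+ con (+ 1)) :* con (+ 3)) refl
  ... | suc (suc (suc _)) | s≤s (s≤s (s≤s ())) | _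

a-exact : ∀ N → a N * + 3 ≡ - (+ M N) + + 5 * r N
a-exact N = /ℕ3-exact _ (divides (+ 3 * + M N - + 5 * + ((2 ℕ.* M N) ℕ./ 3)) (trans (cong (λ x → - (+ M N) + + 5 * x) (r≡ N))
    (lem (+ M N) (+ ((2 ℕ.* M N) ℕ./ 3)))))
  where
  lem : ∀ x y → - x + + 5 * (+ 2 * x - y * + 3) ≡ (+ 3 * x - + 5 * y) * + 3
  lem = solve 2 (λ x y → :- x :+ con (+ 5) :* (con (+ 2) :* x :- y :* con (+ 3))
    := (con (+ 3) :* x :- con (+ 5) :* y) :* con (+ 3)) refl

b-exact : ∀ N → b N * + 3 ≡ + M N - + 8 * r N
b-exact N = /ℕ3-exact _ (divides (- (+ 5) * + M N + + 8 * + ((2 ℕ.* M N) ℕ./ 3)) (trans (cong (λ x → + M N - + 8 * x) (r≡ N))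
    (lem (+ M N) (+ ((2 ℕ.* M N) ℕ./ 3)))))
  where
  lem : ∀ x y → x - + 8 * (+ 2 * x - y * + 3) ≡ (- (+ 5) * x + + 8 * y) * + 3
  lem = solve 2 (λ x y → x :- con (+ 8) :* (con (+ 2) :* x :- y :* con (+ 3))
    := (con (- (+ 5)) :* x :+ con (+ 8) :* y) :* con (+ 3)) refl

w-exact : ∀ j → ¬ (3 ℕ∣.∣ j) →
          ((+ (j ℕ.^ 2) - + 4) /ℕ 3 * + 3 ≡ + (j ℕ.^ 2) - + 4) ×
          ((+ (j ℕ.^ 2) - + 1) /ℕ 3 * + 3 ≡ + (j ℕ.^ 2) - + 1)
w-exact j 3∤j with sq-nonMultiple j 3∤j
... | q , eq = /ℕ3-exact _ (divides (q - + 1) (trans (cong (_- + 4) eq) (lem₄ q)))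
             , /ℕ3-exact _ (divides q (trans (cong (_- + 1) eq) (lem₁ q)))
  where
  lem₄ : ∀ x → (1ℤ + x * + 3) - + 4 ≡ (x - + 1) * + 3
  lem₄ = solve 1 (λ x → (con 1ℤ :+ x :* con (+ 3)) :- con (+ 4)
    := (x :- con (+ 1)) :* con (+ 3)) refl
  lem₁ : ∀ x → (1ℤ + x * + 3) - + 1 ≡ x * + 3
  lem₁ = solve 1 (λ x → (con 1ℤ :+ x :* con (+ 3)) :- con (+ 1) := x :* con (+ 3)) refl

v-exact : ∀ j₁ jₜ → 3 ℕ∣.∣ j₁ → 3 ℕ∣.∣ jₜ →
          (+ (jₜ ℕ.^ 2) - + (j₁ ℕ.^ 2)) /ℕ 3 * + 3 ≡ + (jₜ ℕ.^ 2) - + (j₁ ℕ.^ 2)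
v-exact j₁ jₜ (ℕ∣.divides p refl) (ℕ∣.divides q refl) =
  /ℕ3-exact _ (divides (+ 3 * + q * + q - + 3 * + p * + p) (trans (cong₂ _-_ (sq q) (sq p)) (lem (+ q) (+ p))))
  where
  sq : ∀ n → + ((n ℕ.* 3) ℕ.^ 2) ≡ (+ n * + 3) * (+ n * + 3)
  sq n = trans (pos-sq (n ℕ.* 3)) (cong₂ _*_ (pos-* n 3) (pos-* n 3))
  lem : ∀ x y → (x * + 3) * (x * + 3) - (y * + 3) * (y * + 3)
              ≡ (+ 3 * x * x - + 3 * y * y) * + 3
  lem = solve 2 (λ x y → (x :* con (+ 3)) :* (x :* con (+ 3)) :- (y :* con (+ 3)) :* (y :* con (+ 3))
    := (con (+ 3) :* x :* x :- con (+ 3) :* y :* y) :* con (+ 3)) refl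

{-# OPTIONS --safe #-}
module Submission where

open import Defs
open import Data.Nat.Base using (ℕ; _≤_)
open import Data.Product.Base using (_×_)

-- A basis of a lattice can be split off one vector at a time.  Let f be a
-- linear functional and b a vector of the lattice L such that f b is nonzero
-- and divides every value of f on L.  Each u in L is then a multiple of b plus
-- a vector of the sublattice L ∩ ker f, and the multiple is unique; so b
-- together with a basis of L ∩ ker f is a basis of L (`peel`).
--
-- Write ε j for the j-th coordinate, and σ u and τ u for the sums of the u j
-- and of the j² u j.  For N ≥ 6 the vectors are split off in the order in which
-- they are listed, with these functionals (note that j₁ = 3):
--   z₁      with σ, whose value at z₁ is 12;
--   z₂      with τ, whose value at z₂ is M (on the sublattice σ = 0);
--   w j     with ε j, whose value is 1 at w j and 0 at the other w's;
--   v₀ 3    with ε 1 + ε 2, whose value at v₀ 3 is -3;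
--   v 3 j   with ε j, whose value is 1 at v 3 j and 0 at the other v's.
-- The divisibility is immediate from the definition of Π for z₁ and z₂, and
-- trivial for the w's and v's.  For v₀ it is `3∣headSum`: once the coordinates
-- of index j ≥ 3 prime to 3 vanish, τ u = 0 reads modulo 3 as
-- u 1 + 4 u 2 ≡ 0, so 3 divides u 1 + u 2.
-- What remains at the end are the vectors supported on the coordinates 1, 2, 3
-- with σ = τ = ε 1 + ε 2 = 0, and only the zero vector is one
-- (`remainder-trivial`).
--
-- For N = 5 the first column is split off with σ and the second with ε 2.

open import Data.Bool.Base using (if_then_else_)
open import Data.Empty using (⊥-elim)
open import Data.Fin.Base using (Fin; zero; suc; toℕ)
open import Data.Fin.Properties using (toℕ<n)
open import Data.Integer.Base using (ℤ; +_; -_; _+_; _-_; _*_; 0ℤ; 1ℤ)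
open import Data.Integer.DivMod using (_/ℕ_)
open import Data.Integer.Divisibility.Signed
  using (_∣_; divides; ∣-refl; ∣ᵤ⇒∣; ∣m∣n⇒∣m+n; ∣m∣n⇒∣m-n; ∣m⇒∣m*n; ∣n⇒∣m*n; ∣m+n∣m⇒∣n)
open import Data.Integer.Properties as ℤₚ using (*-cancelʳ-≡; *-identityˡ)
open import Data.Integer.Tactic.RingSolver using (solve-∀)
open import Data.List.Base using (List; []; _∷_; _++_; applyUpTo; filter; lookup; map)
open import Data.List.Membership.Propositional using (_∈_)
open import Data.List.Membership.Propositional.Properties
  using (∈-applyUpTo⁺; ∈-applyUpTo⁻; ∈-filter⁺; ∈-filter⁻)
open import Data.List.Properties using (++-identityʳ)
open import Data.List.Relation.Unary.All as All using (All; []; _∷_)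
open import Data.List.Relation.Unary.AllPairs using ([]; _∷_)
open import Data.List.Relation.Unary.Any using (here; there)
open import Data.List.Relation.Unary.Unique.Propositional using (Unique)
import Data.List.Relation.Unary.Unique.Propositional.Properties as Unique
open import Data.Nat.Base as ℕ using (zero; suc; ⌊_/2⌋; z≤n; s≤s; _<_)
import Data.Nat.Divisibility as ℕ∣
open import Data.Nat.GCD using (gcd[m,n]≢0)
import Data.Nat.Properties as ℕₚ
open import Data.Product.Base using (_,_; proj₁; proj₂)
open import Data.Sum.Base using (inj₁; inj₂)
open import Data.Vec.Functional using (Vector)
open import Function.Base using (_∘_; const)
open import Level using (0ℓ)
open import Relation.Binary.PropositionalEquality
  using (_≡_; _≢_; _≗_; refl; sym; trans; cong; cong₂; subst; module ≡-Reasoning)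
open import Relation.Nullary.Decidable using (¬?; yes; no)
open import Relation.Nullary.Negation using (¬_)
open import Relation.Unary using (Pred; _∩_; _≐_)

open import Algebra.Properties.Semiring.Sum ℤₚ.+-*-semiring
  using (sum; sum-cong-≗; ∑-distrib-+; *-distribˡ-sum; sum-replicate-zero)

open IsBasis
open ≡-Reasoning

private
  variable
    m : ℕ
    L L′ : Pred (Vector ℤ m) 0ℓ

-- Linear functionals

-- The functional with coefficient f j at the j-th coordinate.  As elsewhere,
-- the position i : Fin m has index suc (toℕ i).  Opacity lets f and v be
-- inferred from the type of a statement about pair f v.
opaque
  pair : (ℕ → ℤ) → Vector ℤ m → ℤ
  pair f v = sum (λ i → f (suc (toℕ i)) * v i)

Ker : (ℕ → ℤ) → Pred (Vector ℤ m) 0ℓ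
Ker f v = pair f v ≡ 0ℤ

-- The coefficients of σ and of τ.
one sq : ℕ → ℤ
one _ = 1ℤ
sq j  = + (j ℕ.^ 2)

-- The Kronecker delta; δ j lists the coefficients of ε j, so pair (δ j) v is 0
-- when j is not the index of a coordinate.
δ : ℕ → ℕ → ℤ
δ j k = if k ℕ.≡ᵇ j then 1ℤ else 0ℤ

-- The coefficients of ε 1 + ε 2.
headSum : ℕ → ℤ
headSum j = δ 1 j + δ 2 j

δ-diag : ∀ j → δ j j ≡ 1ℤ
δ-diag zero    = refl
δ-diag (suc j) = δ-diag j

δ-off : ∀ {j k} → j ≢ k → δ j k ≡ 0ℤ
δ-off {zero}  {zero}  j≢k = ⊥-elim (j≢k refl)
δ-off {zero}  {suc k} j≢k = refl
δ-off {suc j} {zero}  j≢k = refl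
δ-off {suc j} {suc k} j≢k = δ-off (j≢k ∘ cong suc)

sum-zero : ∀ {t : Vector ℤ m} → (∀ i → t i ≡ 0ℤ) → sum t ≡ 0ℤ
sum-zero {m} t≗0 = trans (sum-cong-≗ t≗0) (sum-replicate-zero m)

∣-sum : ∀ {d} {t : Vector ℤ m} → (∀ i → d ∣ t i) → d ∣ sum t
∣-sum {zero}  d∣t = divides 0ℤ refl
∣-sum {suc m} d∣t = ∣m∣n⇒∣m+n (d∣t zero) (∣-sum (d∣t ∘ suc))

opaque
  unfolding pair

  pair-cong : ∀ f {u v : Vector ℤ m} → u ≗ v → pair f u ≡ pair f v
  pair-cong f u≗v = sum-cong-≗ (λ i → cong (f (suc (toℕ i)) *_) (u≗v i))

  pair-linear : ∀ f c (u v : Vector ℤ m) →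
                pair f (λ i → c * u i + v i) ≡ c * pair f u + pair f v
  pair-linear {m} f c u v = begin
    sum (λ i → f′ i * (c * u i + v i))
      ≡⟨ sum-cong-≗ (λ i → distrib (f′ i) c (u i) (v i)) ⟩
    sum (λ i → c * (f′ i * u i) + f′ i * v i)
      ≡⟨ ∑-distrib-+ (λ i → c * (f′ i * u i)) (λ i → f′ i * v i) ⟩
    sum (λ i → c * (f′ i * u i)) + pair f v
      ≡⟨ cong (_+ pair f v) (*-distribˡ-sum c (λ i → f′ i * u i)) ⟨
    c * pair f u + pair f v ∎
    where
    f′ : Fin m → ℤ
    f′ i = f (suc (toℕ i))
    distrib : ∀ x c y z → x * (c * y + z) ≡ c * (x * y) + x * z
    distrib = solve-∀

  pair-zero : ∀ {m} f → pair {m} f (const 0ℤ) ≡ 0ℤ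
  pair-zero {m} f = sum-zero {m} (λ i → ℤₚ.*-zeroʳ (f (suc (toℕ i))))

  pair-split : ∀ f g (v : Vector ℤ m) →
               pair f v ≡ pair (λ j → f j - g j) v + pair g v
  pair-split {m} f g v = trans
    (sum-cong-≗ (λ i → split (f (index i)) (g (index i)) (v i)))
    (∑-distrib-+ (λ i → (f (index i) - g (index i)) * v i) (λ i → g (index i) * v i))
    where
    index : Fin m → ℕ
    index i = suc (toℕ i)
    split : ∀ x y z → x * z ≡ (x - y) * z + y * z
    split = solve-∀

  ∣-pair : ∀ {d} f (v : Vector ℤ m) → (∀ i → d ∣ f (suc (toℕ i)) * v i) → d ∣ pair f v
  ∣-pair f v = ∣-sum

  pair-dim-2 : ∀ f (v : Vector ℤ 2) → pair f v ≡ f 1 * v zero + (f 2 * v (suc zero) + 0ℤ)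
  pair-dim-2 f v = refl

  pair-supported-on-3 : ∀ f (v : Vector ℤ (3 ℕ.+ m)) →
    (∀ i → v (suc (suc (suc i))) ≡ 0ℤ) →
    pair f v ≡ f 1 * v zero + (f 2 * v (suc zero) + f 3 * v (suc (suc zero)))
  pair-supported-on-3 {m} f v tail≡0 =
    cong (λ s → f 1 * v zero + (f 2 * v (suc zero) + s))
      (trans (cong (λ s → f 3 * v (suc (suc zero)) + s)
               (sum-zero {m} (λ i → trans (cong (λ x → f (4 ℕ.+ toℕ i) * x) (tail≡0 i))
                                          (ℤₚ.*-zeroʳ (f (4 ℕ.+ toℕ i))))))
             (ℤₚ.+-identityʳ _))

  pair-unit : ∀ f {j} → 1 ≤ j → j ≤ m → pair f (unit {m} j) ≡ f j
  pair-unit f {suc j} _ j<m = go (f ∘ suc) j<m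
    where
    go : ∀ {m} (g : ℕ → ℤ) {j} → j < m →
         sum {m} (λ i → g (toℕ i) * (if toℕ i ℕ.≡ᵇ j then 1ℤ else 0ℤ)) ≡ g j
    go {suc m} g {zero} _ = trans
      (cong₂ _+_ (ℤₚ.*-identityʳ (g 0)) (sum-zero {m} (λ i → ℤₚ.*-zeroʳ (g (suc (toℕ i))))))
      (ℤₚ.+-identityʳ (g 0))
    go {suc m} g {suc j} (s≤s j<m) = trans
      (cong₂ _+_ (ℤₚ.*-zeroʳ (g 0)) (go (g ∘ suc) j<m))
      (ℤₚ.+-identityˡ (g (suc j)))

  pair-δ : ∀ (v : Vector ℤ m) i → pair (δ (suc (toℕ i))) v ≡ v i
  pair-δ v zero = trans
    (cong₂ _+_ (*-identityˡ (v zero)) (sum-zero (λ i → ℤₚ.*-zeroˡ (v (suc i)))))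
    (ℤₚ.+-identityʳ (v zero))
  pair-δ v (suc i) = trans
    (cong₂ _+_ (ℤₚ.*-zeroˡ (v zero)) (pair-δ (v ∘ suc) i))
    (ℤₚ.+-identityˡ (v (suc i)))

  pair-one : ∀ (v : Vector ℤ m) → pair one v ≡ sum v
  pair-one v = sum-cong-≗ (λ i → *-identityˡ (v i))

  pair-sq : ∀ (v : Vector ℤ m) → pair sq v ≡ sum (λ i → + (suc (toℕ i) ℕ.^ 2) * v i)
  pair-sq v = refl

-- Splitting off basis vectors

-- L is closed under the combinations c u + v; this is all that is needed of a
-- subgroup of ℤ^m here.
Closed : Pred (Vector ℤ m) 0ℓ → Set
Closed L = ∀ c {u v} → L u → L v → L (λ i → c * u i + v i)

closed-∩ : Closed L → Closed L′ → Closed (L ∩ L′)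
closed-∩ cl cl′ c (Lu , L′u) (Lv , L′v) = cl c Lu Lv , cl′ c L′u L′v

closed-Ker : ∀ f → Closed (Ker {m} f)
closed-Ker f c {u} {v} fu≡0 fv≡0 = begin
  pair f (λ i → c * u i + v i)  ≡⟨ pair-linear f c u v ⟩
  c * pair f u + pair f v       ≡⟨ cong₂ (λ x y → c * x + y) fu≡0 fv≡0 ⟩
  c * 0ℤ + 0ℤ                   ≡⟨ lem c ⟩
  0ℤ                            ∎
  where
  lem : ∀ c → c * 0ℤ + 0ℤ ≡ 0ℤ
  lem = solve-∀

closed-∣ : ∀ d f → Closed {m} (λ v → d ∣ pair f v)
closed-∣ d f c {u} {v} d∣fu d∣fv =
  subst (d ∣_) (sym (pair-linear f c u v)) (∣m∣n⇒∣m+n (∣n⇒∣m*n c d∣fu) d∣fv)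

-- All coordinates with index in js vanish.
Off : List ℕ → Pred (Vector ℤ m) 0ℓ
Off js v = All (λ j → Ker (δ j) v) js

closed-Off : ∀ js → Closed (Off {m} js)
closed-Off js c {u} {v} zu zv =
  All.zipWith (λ {j} (p , q) → closed-Ker (δ j) c {u} {v} p q) (zu , zv)

basis-resp : ∀ {bs} → L ≐ L′ → IsBasis {m} L bs → IsBasis L′ bs
basis-resp (to , from) B .members k      = to (B .members k)
basis-resp (to , from) B .independent    = B .independent
basis-resp (to , from) B .spanning v L′v = B .spanning v (from L′v)

basis-[] : (∀ {v} → L v → ∀ i → v i ≡ 0ℤ) → IsBasis {m} L []
basis-[] L≗0 .members ()
basis-[] L≗0 .independent _ _ ()
basis-[] L≗0 .spanning v Lv = (λ ()) , λ i → sym (L≗0 Lv i)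

pair-linComb : ∀ f (bs : List (Vector ℤ m)) → (∀ k → Ker f (lookup bs k)) →
               ∀ c → Ker f (linComb bs c)
pair-linComb f []       _  c = pair-zero f
pair-linComb f (b ∷ bs) ms c =
  closed-Ker f (c zero) {b} {linComb bs (c ∘ suc)} (ms zero)
    (pair-linComb f bs (ms ∘ suc) (c ∘ suc))

-- A vector b of L on which f takes a nonzero value dividing all values of f on L
-- completes any basis of L ∩ ker f to a basis of L.
peel : ∀ f {b bs} → Closed L → L b → pair f b ≢ 0ℤ →
       (∀ {v} → L v → pair f b ∣ pair f v) →
       IsBasis {m} (L ∩ Ker f) bs → IsBasis L (b ∷ bs)
peel f cl Lb fb≢0 fb∣ B .members zero    = Lb
peel f cl Lb fb≢0 fb∣ B .members (suc k) = B .members k .proj₁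
peel f {b} {bs} cl Lb fb≢0 fb∣ B .independent c comb≡0 = λ where
    zero    → c₀≡0
    (suc k) → B .independent (c ∘ suc) rest≡0 k
  where
  rest = linComb bs (c ∘ suc)

  frest≡0 : pair f rest ≡ 0ℤ
  frest≡0 = pair-linComb f bs (λ k → B .members k .proj₂) (c ∘ suc)

  c₀*fb≡0 : c zero * pair f b ≡ 0ℤ
  c₀*fb≡0 = begin
    c zero * pair f b                  ≡⟨ ℤₚ.+-identityʳ _ ⟨
    c zero * pair f b + 0ℤ             ≡⟨ cong (λ x → c zero * pair f b + x) frest≡0 ⟨
    c zero * pair f b + pair f rest    ≡⟨ pair-linear f (c zero) b rest ⟨
    pair f (linComb (b ∷ bs) c)        ≡⟨ pair-cong f comb≡0 ⟩
    pair f (const 0ℤ)                  ≡⟨ pair-zero f ⟩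
    0ℤ                                 ∎

  c₀≡0 : c zero ≡ 0ℤ
  c₀≡0 with ℤₚ.i*j≡0⇒i≡0∨j≡0 (c zero) c₀*fb≡0
  ... | inj₁ c₀≡0 = c₀≡0
  ... | inj₂ fb≡0 = ⊥-elim (fb≢0 fb≡0)

  rest≡0 : ∀ i → rest i ≡ 0ℤ
  rest≡0 i = begin
    rest i                  ≡⟨ ℤₚ.+-identityˡ _ ⟨
    0ℤ + rest i             ≡⟨ cong (_+ rest i) (ℤₚ.*-zeroˡ (b i)) ⟨
    0ℤ * b i + rest i       ≡⟨ cong (λ x → x * b i + rest i) c₀≡0 ⟨
    c zero * b i + rest i   ≡⟨ comb≡0 i ⟩
    0ℤ                      ∎
peel f {b} {bs} cl Lb fb≢0 fb∣ B .spanning v Lv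
  with divides q fv≡q*fb ← fb∣ Lv
  = let c , comb≗res = B .spanning residue (cl (- q) Lb Lv , fres≡0)
    in (λ where zero → q
                (suc k) → c k)
     , λ i → trans (cong (λ x → q * b i + x) (comb≗res i)) (restore q (b i) (v i))
  where
  residue = λ i → - q * b i + v i

  fres≡0 : pair f residue ≡ 0ℤ
  fres≡0 = begin
    pair f residue               ≡⟨ pair-linear f (- q) b v ⟩
    - q * pair f b + pair f v    ≡⟨ cong (λ x → - q * pair f b + x) fv≡q*fb ⟩
    - q * pair f b + q * pair f b  ≡⟨ lem q (pair f b) ⟩
    0ℤ                           ∎
    where
    lem : ∀ q x → - q * x + q * x ≡ 0ℤ
    lem = solve-∀

  restore : ∀ q x y → q * x + (- q * x + y) ≡ y
  restore = solve-∀

-- A family b j, for j in js, whose coordinates with index in js form an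
-- identity matrix can be split off as a whole.
peel-units : ∀ {js} {b : ℕ → Vector ℤ m} {bs} → Unique js → Closed L →
             (∀ {j} → j ∈ js → L (b j)) →
             (∀ {j k} → j ∈ js → k ∈ js → pair (δ j) (b k) ≡ δ j k) →
             IsBasis (L ∩ Off js) bs → IsBasis L (map b js ++ bs)
peel-units {js = []} _ cl Lb dual B = basis-resp (proj₁ , λ Lv → Lv , []) B
peel-units {L = L} {js = j ∷ js} {b} (j∉js ∷ js!) cl Lb dual B =
  peel (δ j) cl (Lb (here refl))
    (λ p → 1≢0 (trans (sym δbj≡1) p))
    (λ {v} _ → subst (_∣ pair (δ j) v) (sym δbj≡1) (divides (pair (δ j) v) (sym (ℤₚ.*-identityʳ _))))
    (peel-units js! (closed-∩ cl (closed-Ker (δ j)))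
      (λ k∈ → Lb (there k∈)
            , trans (dual (here refl) (there k∈)) (δ-off (All.lookup j∉js k∈)))
      (λ i∈ k∈ → dual (there i∈) (there k∈))
      (basis-resp ((λ where (Lv , z ∷ zs) → (Lv , z) , zs)
                  , λ where ((Lv , z) , zs) → Lv , z ∷ zs) B))
  where
  1≢0 : 1ℤ ≢ 0ℤ
  1≢0 ()
  δbj≡1 : pair (δ j) (b j) ≡ 1ℤ
  δbj≡1 = trans (dual (here refl) (here refl)) (δ-diag j)

-- The index lists

-- The bound is 4, not 3, because 3 is itself a multiple of 3.
∈-nonMultiples⁻ : ∀ {k j} → j ∈ nonMultiples (3 ℕ.+ k) →
                  4 ≤ j × j ≤ 3 ℕ.+ k × ¬ 3 ℕ∣.∣ j
∈-nonMultiples⁻ {k} j∈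
  with j∈′ , 3∤j ← ∈-filter⁻ (λ j → ¬? (3 ℕ∣.∣? j)) {xs = from3To (3 ℕ.+ k)} j∈
  with ∈-applyUpTo⁻ (3 ℕ.+_) j∈′
... | zero  , _       , refl = ⊥-elim (3∤j ℕ∣.∣-refl)
... | suc x , s≤s x<k , refl = s≤s (s≤s (s≤s (s≤s z≤n))) , s≤s (s≤s (s≤s x<k)) , 3∤j

∈-nonMultiples⁺ : ∀ {k x} → x ≤ k → ¬ 3 ℕ∣.∣ 3 ℕ.+ x → 3 ℕ.+ x ∈ nonMultiples (3 ℕ.+ k)
∈-nonMultiples⁺ x≤k 3∤j =
  ∈-filter⁺ (λ j → ¬? (3 ℕ∣.∣? j)) (∈-applyUpTo⁺ (3 ℕ.+_) (s≤s x≤k)) 3∤j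

nonMultiples-unique : ∀ m → Unique (nonMultiples m)
nonMultiples-unique m = Unique.filter⁺ (λ j → ¬? (3 ℕ∣.∣? j))
  (Unique.applyUpTo⁺₁ (3 ℕ.+_) (m ℕ.∸ 2) (λ i<j _ → ℕₚ.<⇒≢ (s≤s (s≤s (s≤s i<j)))))

-- The multiples j₂ < … < jᵣ of 3 in {4, …, 3 + k}.  Since j₁ = 3, the list
-- `multiples (3 + k)` reduces to 3 ∷ laterMultiples k.
laterMultiples : ℕ → List ℕ
laterMultiples k = filter (3 ℕ∣.∣?_) (applyUpTo (4 ℕ.+_) k)

∈-laterMultiples⁻ : ∀ {k j} → j ∈ laterMultiples k → 4 ≤ j × j ≤ 3 ℕ.+ k × 3 ℕ∣.∣ j
∈-laterMultiples⁻ {k} j∈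
  with j∈′ , 3∣j ← ∈-filter⁻ (3 ℕ∣.∣?_) {xs = applyUpTo (4 ℕ.+_) k} j∈
  with x , x<k , refl ← ∈-applyUpTo⁻ (4 ℕ.+_) j∈′
  = s≤s (s≤s (s≤s (s≤s z≤n))) , s≤s (s≤s (s≤s x<k)) , 3∣j

∈-laterMultiples⁺ : ∀ {k x} → x < k → 3 ℕ∣.∣ 4 ℕ.+ x → 4 ℕ.+ x ∈ laterMultiples k
∈-laterMultiples⁺ x<k 3∣j = ∈-filter⁺ (3 ℕ∣.∣?_) (∈-applyUpTo⁺ (4 ℕ.+_) x<k) 3∣j

laterMultiples-unique : ∀ k → Unique (laterMultiples k)
laterMultiples-unique k = Unique.filter⁺ (3 ℕ∣.∣?_)
  (Unique.applyUpTo⁺₁ (4 ℕ.+_) k (λ i<j _ → ℕₚ.<⇒≢ (s≤s (s≤s (s≤s (s≤s i<j))))))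

-- Values of functionals on the basis vectors

-- Each basis vector has at most four nonzero coordinates, namely those of
-- index 1, 2 and two further ones p and q.
pair-combination : ∀ f x y z t {p q} {u : Vector ℤ (2 ℕ.+ m)} →
  1 ≤ p → p ≤ 2 ℕ.+ m → 1 ≤ q → q ≤ 2 ℕ.+ m →
  (∀ i → u i ≡ x * unit 1 i + (y * unit 2 i + (z * unit p i + (t * unit q i + 0ℤ)))) →
  pair f u ≡ x * f 1 + (y * f 2 + (z * f p + (t * f q + 0ℤ)))
pair-combination {m} f x y z t {p} {q} {u} 1≤p p≤ 1≤q q≤ eq = begin
  pair f u
    ≡⟨ pair-cong f eq ⟩
  pair f (λ i → x * unit 1 i + (y * unit 2 i + (z * unit p i + (t * unit q i + 0ℤ))))
    ≡⟨ term x (s≤s z≤n) (s≤s z≤n)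
       (term y (s≤s z≤n) (s≤s (s≤s z≤n))
       (term z 1≤p p≤ (term t 1≤q q≤ (pair-zero f)))) ⟩
  x * f 1 + (y * f 2 + (z * f p + (t * f q + 0ℤ))) ∎
  where
  term : ∀ c {j v s} → 1 ≤ j → j ≤ 2 ℕ.+ m → pair f v ≡ s →
         pair f (λ i → c * unit {2 ℕ.+ m} j i + v i) ≡ c * f j + s
  term c {j} {v} 1≤j j≤ fv≡s = trans (pair-linear f c (unit j) v)
    (cong₂ (λ a b → c * a + b) (pair-unit f 1≤j j≤) fv≡s)

module _ {k : ℕ} where

  private
    1≤3 : 1 ≤ 3
    1≤3 = s≤s z≤n
    3≤m : 3 ≤ 3 ℕ.+ k
    3≤m = s≤s (s≤s (s≤s z≤n))

  pair-z₁ : ∀ f → pair f (z₁ {3 ℕ.+ k}) ≡ + 16 * f 1 - + 4 * f 2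
  pair-z₁ f = trans
    (pair-combination f (+ 16) (- + 4) 0ℤ 0ℤ 1≤3 3≤m 1≤3 3≤m
      (λ i → expand (unit 1 i) (unit 2 i) (unit 3 i)))
    (sym (expand (f 1) (f 2) (f 3)))
    where
    expand : ∀ x y z → + 16 * x - + 4 * y ≡ + 16 * x + (- + 4 * y + (0ℤ * z + (0ℤ * z + 0ℤ)))
    expand = solve-∀

  pair-z₂ : ∀ f N → pair f (z₂ {3 ℕ.+ k} N) ≡ a N * f 1 + b N * f 2 + r N * f 3
  pair-z₂ f N = trans
    (pair-combination f (a N) (b N) (r N) 0ℤ 1≤3 3≤m 1≤3 3≤m
      (λ i → expand (a N) (b N) (r N) (unit 1 i) (unit 2 i) (unit 3 i)))
    (sym (expand (a N) (b N) (r N) (f 1) (f 2) (f 3)))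
    where
    expand : ∀ a b r x y z → a * x + b * y + r * z ≡ a * x + (b * y + (r * z + (0ℤ * z + 0ℤ)))
    expand = solve-∀

  pair-w : ∀ f {j} → 1 ≤ j → j ≤ 3 ℕ.+ k →
    pair f (w {3 ℕ.+ k} j) ≡ (sq j - + 4) /ℕ 3 * f 1 - (sq j - + 1) /ℕ 3 * f 2 + f j
  pair-w f {j} 1≤j j≤ = trans
    (pair-combination f α (- β) 1ℤ 0ℤ 1≤j j≤ 1≤j j≤
      (λ i → expand α β (unit 1 i) (unit 2 i) (unit j i)))
    (sym (expand α β (f 1) (f 2) (f j)))
    where
    α = (sq j - + 4) /ℕ 3
    β = (sq j - + 1) /ℕ 3
    expand : ∀ α β x y z → α * x - β * y + z ≡ α * x + (- β * y + (1ℤ * z + (0ℤ * z + 0ℤ)))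
    expand = solve-∀

  pair-v₀ : ∀ f → pair f (v₀ {3 ℕ.+ k} 3) ≡ + 5 * f 1 - + 8 * f 2 + + 3 * f 3
  pair-v₀ f = trans
    (pair-combination f (+ 5) (- + 8) (+ 3) 0ℤ 1≤3 3≤m 1≤3 3≤m
      (λ i → expand (unit 1 i) (unit 2 i) (unit 3 i)))
    (sym (expand (f 1) (f 2) (f 3)))
    where
    expand : ∀ x y z → + 5 * x - + 8 * y + + 3 * z ≡ + 5 * x + (- + 8 * y + (+ 3 * z + (0ℤ * z + 0ℤ)))
    expand = solve-∀

  pair-v : ∀ f {j} → 1 ≤ j → j ≤ 3 ℕ.+ k →
    pair f (v {3 ℕ.+ k} 3 j) ≡
      (sq j - + 9) /ℕ 3 * f 1 - (sq j - + 9) /ℕ 3 * f 2 - f 3 + f j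
  pair-v f {j} 1≤j j≤ = trans
    (pair-combination f α (- α) (- 1ℤ) 1ℤ 1≤3 3≤m 1≤j j≤
      (λ i → expand α (unit 1 i) (unit 2 i) (unit 3 i) (unit j i)))
    (sym (expand α (f 1) (f 2) (f 3) (f j)))
    where
    α = (sq j - + 9) /ℕ 3
    expand : ∀ α x y z t → α * x - α * y - z + t ≡ α * x + (- α * y + (- 1ℤ * z + (1ℤ * t + 0ℤ)))
    expand = solve-∀

-- The lattice σ = τ = 0

-- The vectors with σ = τ = 0.  All of the w's and v's lie in it.
K : Pred (Vector ℤ m) 0ℓ
K = Ker one ∩ Ker sq

closed-K : Closed (K {m})
closed-K = closed-∩ {L = Ker one} {L′ = Ker sq} (closed-Ker one) (closed-Ker sq)

3x≡3y⇒x≡y : ∀ {x y} → x * + 3 ≡ y * + 3 → x ≡ y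
3x≡3y⇒x≡y {x} {y} = *-cancelʳ-≡ x y (+ 3)

δ-head : ∀ {j} → 4 ≤ j → δ j 1 ≡ 0ℤ × δ j 2 ≡ 0ℤ × δ j 3 ≡ 0ℤ
δ-head (s≤s (s≤s (s≤s (s≤s _)))) = refl , refl , refl

headSum-tail : ∀ {j} → 4 ≤ j → headSum j ≡ 0ℤ
headSum-tail (s≤s (s≤s (s≤s (s≤s _)))) = refl

1≤-from-4≤ : ∀ {j} → 4 ≤ j → 1 ≤ j
1≤-from-4≤ (s≤s _) = s≤s z≤n

module _ {k : ℕ} where

  private
    nm later : List ℕ
    nm    = nonMultiples (3 ℕ.+ k)
    later = laterMultiples k

  w∈K : ∀ {j} → j ∈ nm → K (w {3 ℕ.+ k} j)
  w∈K {j} j∈ with 4≤j , j≤ , 3∤j ← ∈-nonMultiples⁻ {k} j∈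
             with α-exact , β-exact ← w-exact j 3∤j
    = trans (pair-w one (1≤-from-4≤ 4≤j) j≤) (3x≡3y⇒x≡y (begin
        (α * 1ℤ - β * 1ℤ + 1ℤ) * + 3    ≡⟨ σ-form α β ⟩
        α * + 3 - β * + 3 + + 3         ≡⟨ cong₂ (λ x y → x - y + + 3) α-exact β-exact ⟩
        s - + 4 - (s - + 1) + + 3       ≡⟨ σ-zero s ⟩
        0ℤ * + 3                        ∎))
    , trans (pair-w sq (1≤-from-4≤ 4≤j) j≤) (3x≡3y⇒x≡y (begin
        (α * + 1 - β * + 4 + s) * + 3   ≡⟨ τ-form α β s ⟩
        α * + 3 - β * + 3 * + 4 + s * + 3
          ≡⟨ cong₂ (λ x y → x - y * + 4 + s * + 3) α-exact β-exact ⟩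
        s - + 4 - (s - + 1) * + 4 + s * + 3  ≡⟨ τ-zero s ⟩
        0ℤ * + 3                        ∎))
    where
    s = sq j
    α = (s - + 4) /ℕ 3
    β = (s - + 1) /ℕ 3
    σ-form : ∀ α β → (α * 1ℤ - β * 1ℤ + 1ℤ) * + 3 ≡ α * + 3 - β * + 3 + + 3
    σ-form = solve-∀
    σ-zero : ∀ s → s - + 4 - (s - + 1) + + 3 ≡ 0ℤ * + 3
    σ-zero = solve-∀
    τ-form : ∀ α β s → (α * + 1 - β * + 4 + s) * + 3 ≡ α * + 3 - β * + 3 * + 4 + s * + 3
    τ-form = solve-∀
    τ-zero : ∀ s → s - + 4 - (s - + 1) * + 4 + s * + 3 ≡ 0ℤ * + 3
    τ-zero = solve-∀

  w-dual : ∀ {i j} → i ∈ nm → j ∈ nm → pair (δ i) (w {3 ℕ.+ k} j) ≡ δ i j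
  w-dual {i} {j} i∈ j∈
    with 4≤i , _ ← ∈-nonMultiples⁻ {k} i∈ | 4≤j , j≤ , _ ← ∈-nonMultiples⁻ {k} j∈
    with δ₁ , δ₂ , _ ← δ-head 4≤i
    = trans (pair-w (δ i) (1≤-from-4≤ 4≤j) j≤)
        (trans (cong₂ (λ x y → α * x - β * y + δ i j) δ₁ δ₂) (simplify α β (δ i j)))
    where
    α = (sq j - + 4) /ℕ 3
    β = (sq j - + 1) /ℕ 3
    simplify : ∀ α β d → α * 0ℤ - β * 0ℤ + d ≡ d
    simplify = solve-∀

  v₀∈K : K (v₀ {3 ℕ.+ k} 3)
  v₀∈K = pair-v₀ one , pair-v₀ sq

  v₀-off : Off nm (v₀ {3 ℕ.+ k} 3)
  v₀-off = All.tabulate λ {j} j∈ → off j (∈-nonMultiples⁻ {k} j∈ .proj₁)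
    where
    off : ∀ j → 4 ≤ j → Ker (δ j) (v₀ {3 ℕ.+ k} 3)
    off j (s≤s (s≤s (s≤s (s≤s _)))) = pair-v₀ (δ j)

  pair-headSum-v₀ : pair headSum (v₀ {3 ℕ.+ k} 3) ≡ - + 3
  pair-headSum-v₀ = pair-v₀ headSum

  v∈K : ∀ {j} → j ∈ later → K (v {3 ℕ.+ k} 3 j)
  v∈K {j} j∈ with 4≤j , j≤ , 3∣j ← ∈-laterMultiples⁻ {k} j∈
    = trans (pair-v one (1≤-from-4≤ 4≤j) j≤) (σ-zero α)
    , trans (pair-v sq (1≤-from-4≤ 4≤j) j≤) (3x≡3y⇒x≡y (begin
        (α * + 1 - α * + 4 - + 9 + s) * + 3   ≡⟨ τ-form α s ⟩
        α * + 3 * (- + 3) - + 27 + s * + 3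
          ≡⟨ cong (λ x → x * (- + 3) - + 27 + s * + 3) (v-exact 3 j ℕ∣.∣-refl 3∣j) ⟩
        (s - + 9) * (- + 3) - + 27 + s * + 3  ≡⟨ τ-zero s ⟩
        0ℤ * + 3                              ∎))
    where
    s = sq j
    α = (s - + 9) /ℕ 3
    σ-zero : ∀ α → α * 1ℤ - α * 1ℤ - 1ℤ + 1ℤ ≡ 0ℤ
    σ-zero = solve-∀
    τ-form : ∀ α s → (α * + 1 - α * + 4 - + 9 + s) * + 3 ≡ α * + 3 * (- + 3) - + 27 + s * + 3
    τ-form = solve-∀
    τ-zero : ∀ s → (s - + 9) * (- + 3) - + 27 + s * + 3 ≡ 0ℤ * + 3
    τ-zero = solve-∀

  pair-δ-v : ∀ {i j} → 4 ≤ i → 4 ≤ j → j ≤ 3 ℕ.+ k → pair (δ i) (v {3 ℕ.+ k} 3 j) ≡ δ i j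
  pair-δ-v {i} {j} (s≤s (s≤s (s≤s (s≤s _)))) 4≤j j≤ =
    trans (pair-v (δ i) (1≤-from-4≤ 4≤j) j≤) (simplify ((sq j - + 9) /ℕ 3) (δ i j))
    where
    simplify : ∀ α d → α * 0ℤ - α * 0ℤ - 0ℤ + d ≡ d
    simplify = solve-∀

  v-dual : ∀ {i j} → i ∈ later → j ∈ later → pair (δ i) (v {3 ℕ.+ k} 3 j) ≡ δ i j
  v-dual i∈ j∈ with 4≤i , _ ← ∈-laterMultiples⁻ {k} i∈
                  | 4≤j , j≤ , _ ← ∈-laterMultiples⁻ {k} j∈
    = pair-δ-v 4≤i 4≤j j≤

  v-off : ∀ {j} → j ∈ later → Off nm (v {3 ℕ.+ k} 3 j)
  v-off {j} j∈ with 4≤j , j≤ , 3∣j ← ∈-laterMultiples⁻ {k} j∈ = All.tabulate λ {i} i∈ →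
    let 4≤i , _ , 3∤i = ∈-nonMultiples⁻ {k} i∈ in
    trans (pair-δ-v 4≤i 4≤j j≤) (δ-off {i} {j} λ i≡j → 3∤i (subst (3 ℕ∣.∣_) (sym i≡j) 3∣j))

  headSum-v : ∀ {j} → j ∈ later → Ker headSum (v {3 ℕ.+ k} 3 j)
  headSum-v {j} j∈ with 4≤j , j≤ , _ ← ∈-laterMultiples⁻ {k} j∈ =
    trans (pair-v headSum (1≤-from-4≤ 4≤j) j≤)
      (trans (cong (λ x → α * 1ℤ - α * 1ℤ - 0ℤ + x) (headSum-tail 4≤j)) (simplify α))
    where
    α = (sq j - + 9) /ℕ 3
    simplify : ∀ α → α * 1ℤ - α * 1ℤ - 0ℤ + 0ℤ ≡ 0ℤ
    simplify = solve-∀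

  coordinate≡0 : ∀ {v : Vector ℤ (3 ℕ.+ k)} {js} i → Off js v → suc (toℕ i) ∈ js → v i ≡ 0ℤ
  coordinate≡0 {v} i off i∈ = trans (sym (pair-δ v i)) (All.lookup off i∈)

  -- Modulo 3, j² is 1 for j = 1, 2 and 0 for the other j at which v may be
  -- nonzero, so τ v and the value of `headSum` at v agree
  -- modulo 3.
  3∣headSum : ∀ {v : Vector ℤ (3 ℕ.+ k)} → Ker sq v → Off nm v → + 3 ∣ pair headSum v
  3∣headSum {v} τ≡0 off =
    ∣m+n∣m⇒∣n (subst (+ 3 ∣_) (trans (sym τ≡0) (pair-split sq headSum v)) (divides 0ℤ refl))
              (∣-pair (λ j → sq j - headSum j) v term)
    where
    term : ∀ i → + 3 ∣ (sq (suc (toℕ i)) - headSum (suc (toℕ i))) * v i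
    term zero       = ∣m⇒∣m*n (v zero) (divides 0ℤ refl)
    term (suc zero) = ∣m⇒∣m*n (v (suc zero)) (divides 1ℤ refl)
    term i@(suc (suc i′)) with 3 ℕ∣.∣? suc (toℕ i)
    ... | yes 3∣j = ∣m⇒∣m*n (v i)
      (∣m∣n⇒∣m-n
        (∣ᵤ⇒∣ {+ 3} {sq (suc (toℕ i))} (ℕ∣.∣m⇒∣m*n (suc (toℕ i) ℕ.^ 1) 3∣j))
        (divides 0ℤ refl))
    ... | no  3∤j = ∣n⇒∣m*n (sq (suc (toℕ i)) - headSum (suc (toℕ i)))
      (subst (+ 3 ∣_) (sym (coordinate≡0 i off (∈-nonMultiples⁺ (ℕₚ.≤-pred (toℕ<n i′)) 3∤j)))
        (divides 0ℤ refl))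

  remainder-trivial : ∀ {v : Vector ℤ (3 ℕ.+ k)} →
    K v → Off nm v → Ker headSum v → Off later v → ∀ i → v i ≡ 0ℤ
  remainder-trivial {v} (σ≡0 , τ≡0) offₙ head≡0 offₗ = λ where
      zero                → x≡0
      (suc zero)          → y≡0
      (suc (suc zero))    → z≡0
      (suc (suc (suc i))) → tail≡0 i
    where
    tail≡0 : ∀ i → v (suc (suc (suc i))) ≡ 0ℤ
    tail≡0 i with 3 ℕ∣.∣? 4 ℕ.+ toℕ i
    ... | yes 3∣j = coordinate≡0 (suc (suc (suc i))) offₗ (∈-laterMultiples⁺ (toℕ<n i) 3∣j)
    ... | no  3∤j = coordinate≡0 (suc (suc (suc i))) offₙ (∈-nonMultiples⁺ (toℕ<n i) 3∤j)

    x = v zero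
    y = v (suc zero)
    z = v (suc (suc zero))

    reduce : ∀ f → Ker f v → f 1 * x + (f 2 * y + f 3 * z) ≡ 0ℤ
    reduce f fv≡0 = trans (sym (pair-supported-on-3 f v tail≡0)) fv≡0

    z≡0 : z ≡ 0ℤ
    z≡0 = trans (solve-z x y z) (cong₂ _-_ (reduce one σ≡0) (reduce headSum head≡0))
      where
      solve-z : ∀ x y z → z ≡ (1ℤ * x + (1ℤ * y + 1ℤ * z)) - (1ℤ * x + (1ℤ * y + 0ℤ * z))
      solve-z = solve-∀

    y≡0 : y ≡ 0ℤ
    y≡0 = 3x≡3y⇒x≡y (trans (solve-y x y z)
      (trans (cong₂ (λ s t → s - t - + 9 * z) (reduce sq τ≡0) (reduce headSum head≡0))
             (cong (λ z → 0ℤ - 0ℤ - + 9 * z) z≡0)))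
      where
      solve-y : ∀ x y z → y * + 3 ≡
        (+ 1 * x + (+ 4 * y + + 9 * z)) - (1ℤ * x + (1ℤ * y + 0ℤ * z)) - + 9 * z
      solve-y = solve-∀

    x≡0 : x ≡ 0ℤ
    x≡0 = trans (solve-x x y z) (cong₂ _-_ (reduce headSum head≡0) y≡0)
      where
      solve-x : ∀ x y z → x ≡ (1ℤ * x + (1ℤ * y + 0ℤ * z)) - y
      solve-x = solve-∀

  basis-K : IsBasis K (map w nm ++ vs (multiples (3 ℕ.+ k)))
  basis-K =
    peel-units {L = K} (nonMultiples-unique (3 ℕ.+ k)) closed-K w∈K w-dual
      (peel {L = L₁} headSum closed-L₁ (v₀∈K , v₀-off) head≢0 head∣
        (subst (IsBasis (L₁ ∩ Ker headSum)) (++-identityʳ (map (v 3) later))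
          (peel-units {L = L₁ ∩ Ker headSum} (laterMultiples-unique k)
            (closed-∩ {L = L₁} {L′ = Ker headSum} closed-L₁ (closed-Ker headSum))
            (λ j∈ → (v∈K j∈ , v-off j∈) , headSum-v j∈)
            v-dual
            (basis-[] λ where (((Kv , offₙ) , head≡0) , offₗ) →
                                remainder-trivial Kv offₙ head≡0 offₗ))))
    where
    L₁ : Pred (Vector ℤ (3 ℕ.+ k)) 0ℓ
    L₁ = K ∩ Off nm

    closed-L₁ : Closed L₁
    closed-L₁ = closed-∩ {L = K} {L′ = Off nm} closed-K (closed-Off nm)

    head≢0 : pair headSum (v₀ {3 ℕ.+ k} 3) ≢ 0ℤ
    head≢0 p with () ← trans (sym pair-headSum-v₀) p

    -3∣ : ∀ {x} → + 3 ∣ x → - + 3 ∣ x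
    -3∣ (divides q refl) = divides (- q) (lem q)
      where
      lem : ∀ q → q * + 3 ≡ - q * (- + 3)
      lem = solve-∀

    head∣ : ∀ {u} → L₁ u → pair headSum (v₀ {3 ℕ.+ k} 3) ∣ pair headSum u
    head∣ {u} ((_ , τ≡0) , off) =
      subst (_∣ pair headSum u) (sym pair-headSum-v₀) (-3∣ (3∣headSum τ≡0 off))

-- The lattice Π

-- `Π N` with both sums written as functionals, in any dimension.
Π′ : ℕ → Pred (Vector ℤ m) 0ℓ
Π′ N v = + 12 ∣ pair one v × + M N ∣ pair sq v

Π′≐Π : ∀ N → Π′ N ≐ Π N
Π′≐Π N =
    (λ {v} (p , q) → subst (+ 12 ∣_) (pair-one v) p , subst (+ M N ∣_) (pair-sq v) q)
  , (λ {v} (p , q) → subst (+ 12 ∣_) (sym (pair-one v)) p , subst (+ M N ∣_) (sym (pair-sq v)) q)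

closed-Π′ : ∀ N → Closed {m} (Π′ N)
closed-Π′ N = closed-∩ {L = λ v → + 12 ∣ pair one v} {L′ = λ v → + M N ∣ pair sq v}
  (closed-∣ (+ 12) one) (closed-∣ (+ M N) sq)

0-divisible : ∀ {d} → d ∣ 0ℤ
0-divisible {d} = divides 0ℤ (sym (ℤₚ.*-zeroˡ d))

M≢0 : ∀ N → N ≢ 0 → + M N ≢ 0ℤ
M≢0 N N≢0 M≡0 with ℕₚ.m*n≡0⇒m≡0∨n≡0 N (ℤₚ.+-injective M≡0)
... | inj₁ N≡0   = N≢0 N≡0
... | inj₂ gcd≡0 = gcd[m,n]≢0 2 N (inj₁ λ ()) gcd≡0

module _ {k : ℕ} (N : ℕ) where

  pair-one-z₂ : Ker one (z₂ {3 ℕ.+ k} N)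
  pair-one-z₂ = trans (pair-z₂ one N) (3x≡3y⇒x≡y (begin
    (a N * 1ℤ + b N * 1ℤ + r N * 1ℤ) * + 3  ≡⟨ form (a N) (b N) (r N) ⟩
    a N * + 3 + b N * + 3 + r N * + 3
      ≡⟨ cong₂ (λ x y → x + y + r N * + 3) (a-exact N) (b-exact N) ⟩
    - (+ M N) + + 5 * r N + (+ M N - + 8 * r N) + r N * + 3  ≡⟨ value (+ M N) (r N) ⟩
    0ℤ * + 3                                ∎))
    where
    form : ∀ a b r → (a * 1ℤ + b * 1ℤ + r * 1ℤ) * + 3 ≡ a * + 3 + b * + 3 + r * + 3
    form = solve-∀
    value : ∀ M r → - M + + 5 * r + (M - + 8 * r) + r * + 3 ≡ 0ℤ * + 3
    value = solve-∀

  pair-sq-z₂ : pair sq (z₂ {3 ℕ.+ k} N) ≡ + M N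
  pair-sq-z₂ = trans (pair-z₂ sq N) (3x≡3y⇒x≡y (begin
    (a N * + 1 + b N * + 4 + r N * + 9) * + 3      ≡⟨ form (a N) (b N) (r N) ⟩
    a N * + 3 + b N * + 3 * + 4 + r N * + 27
      ≡⟨ cong₂ (λ x y → x + y * + 4 + r N * + 27) (a-exact N) (b-exact N) ⟩
    - (+ M N) + + 5 * r N + (+ M N - + 8 * r N) * + 4 + r N * + 27  ≡⟨ value (+ M N) (r N) ⟩
    + M N * + 3                                    ∎))
    where
    form : ∀ a b r → (a * + 1 + b * + 4 + r * + 9) * + 3 ≡ a * + 3 + b * + 3 * + 4 + r * + 27
    form = solve-∀
    value : ∀ M r → - M + + 5 * r + (M - + 8 * r) * + 4 + r * + 27 ≡ M * + 3
    value = solve-∀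

  basis-Π′ : N ≢ 0 → IsBasis (Π′ N)
    (z₁ ∷ z₂ N ∷ map w (nonMultiples (3 ℕ.+ k)) ++ vs (multiples (3 ℕ.+ k)))
  basis-Π′ N≢0 =
    peel {L = Π′ N} one (closed-Π′ N) z₁∈Π′ (λ p → 12≢0 (trans (sym σz₁) p))
      (λ {u} (12∣ , _) → subst (_∣ pair one u) (sym σz₁) 12∣)
      (peel {L = L₁} sq (closed-∩ {L = Π′ N} {L′ = Ker one} (closed-Π′ N) (closed-Ker one))
        z₂∈L₁ (λ p → M≢0 N N≢0 (trans (sym pair-sq-z₂) p))
        (λ {u} ((_ , M∣) , _) → subst (_∣ pair sq u) (sym pair-sq-z₂) M∣)
        (basis-resp (K⊆ , λ ((_ , σ≡0) , τ≡0) → σ≡0 , τ≡0) basis-K))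
    where
    L₁ : Pred (Vector ℤ (3 ℕ.+ k)) 0ℓ
    L₁ = Π′ N ∩ Ker one

    12≢0 : + 12 ≢ 0ℤ
    12≢0 ()

    σz₁ : pair one (z₁ {3 ℕ.+ k}) ≡ + 12
    σz₁ = pair-z₁ one

    z₁∈Π′ : Π′ N (z₁ {3 ℕ.+ k})
    z₁∈Π′ = subst (+ 12 ∣_) (sym σz₁) ∣-refl
          , subst (+ M N ∣_) (sym (pair-z₁ sq)) 0-divisible

    z₂∈L₁ : L₁ (z₂ N)
    z₂∈L₁ = ( subst (+ 12 ∣_) (sym pair-one-z₂) 0-divisible
            , subst (+ M N ∣_) (sym pair-sq-z₂) ∣-refl)
          , pair-one-z₂

    K⊆ : ∀ {u} → K u → (L₁ ∩ Ker sq) u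
    K⊆ (σ≡0 , τ≡0) =
      (( subst (+ 12 ∣_) (sym σ≡0) 0-divisible
       , subst (+ M N ∣_) (sym τ≡0) 0-divisible) , σ≡0) , τ≡0

basis-Π : ∀ N → 6 ≤ N → IsBasis (Π N) (ℬ N)
basis-Π N@(suc (suc (suc (suc (suc (suc n)))))) (s≤s (s≤s (s≤s (s≤s (s≤s (s≤s _)))))) =
  basis-resp (Π′≐Π N) (basis-Π′ {⌊ n /2⌋} N λ ())

basis-Π₅ : IsBasis (Π 5) (columns B₅)
basis-Π₅ = basis-resp (Π′≐Π 5)
  (peel {L = Π′ 5} one (closed-Π′ 5) c₁∈Π′ (λ p → 12≢0 (trans (sym (pair-dim-2 one c₁)) p))
    (λ {u} (12∣ , _) → subst (_∣ pair one u) (sym (pair-dim-2 one c₁)) 12∣)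
    (peel {L = L₁} (δ 2) (closed-∩ {L = Π′ 5} {L′ = Ker one} (closed-Π′ 5) (closed-Ker one))
      c₂∈L₁ (λ p → 5≢0 (trans (sym (pair-dim-2 (δ 2) c₂)) p))
      (λ {u} L₁u → subst (_∣ pair (δ 2) u) (sym (pair-dim-2 (δ 2) c₂)) (5∣ε₂ L₁u))
      (basis-[] trivial)))
  where
  c₁ c₂ : Vector ℤ 2
  c₁ = lookup (columns B₅) zero
  c₂ = lookup (columns B₅) (suc zero)

  L₁ : Pred (Vector ℤ 2) 0ℓ
  L₁ = Π′ 5 ∩ Ker one

  12≢0 : + 12 ≢ 0ℤ
  12≢0 ()

  5≢0 : + 5 ≢ 0ℤ
  5≢0 ()

  c₁∈Π′ : Π′ 5 c₁
  c₁∈Π′ = subst (+ 12 ∣_) (sym (pair-dim-2 one c₁)) ∣-refl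
        , subst (+ 5 ∣_) (sym (pair-dim-2 sq c₁)) 0-divisible

  c₂∈L₁ : L₁ c₂
  c₂∈L₁ = ( subst (+ 12 ∣_) (sym (pair-dim-2 one c₂)) 0-divisible
          , subst (+ 5 ∣_) (sym (pair-dim-2 sq c₂)) (divides (+ 3) refl))
        , pair-dim-2 one c₂

  -- From x + y = 0 and x + 4 y = 5 q one gets 3 y = 5 q, so y = 5 (2 q - y).
  5∣ε₂ : ∀ {u} → L₁ u → + 5 ∣ pair (δ 2) u
  5∣ε₂ {u} ((_ , divides q τ≡q5) , σ≡0) = divides (+ 2 * q - y) (begin
    pair (δ 2) u               ≡⟨ pair-dim-2 (δ 2) u ⟩
    0ℤ * x + (1ℤ * y + 0ℤ)     ≡⟨ combine x y ⟩
    + 2 * τ - + 2 * σ - + 5 * y  ≡⟨ cong₂ (λ t s → + 2 * t - + 2 * s - + 5 * y)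
                                     (trans (sym (pair-dim-2 sq u)) τ≡q5)
                                     (trans (sym (pair-dim-2 one u)) σ≡0) ⟩
    + 2 * (q * + 5) - + 2 * 0ℤ - + 5 * y  ≡⟨ factor q y ⟩
    (+ 2 * q - y) * + 5        ∎)
    where
    x = u zero
    y = u (suc zero)
    σ = 1ℤ * x + (1ℤ * y + 0ℤ)
    τ = + 1 * x + (+ 4 * y + 0ℤ)
    combine : ∀ x y → 0ℤ * x + (1ℤ * y + 0ℤ) ≡
      + 2 * (+ 1 * x + (+ 4 * y + 0ℤ)) - + 2 * (1ℤ * x + (1ℤ * y + 0ℤ)) - + 5 * y
    combine = solve-∀
    factor : ∀ q y → + 2 * (q * + 5) - + 2 * 0ℤ - + 5 * y ≡ (+ 2 * q - y) * + 5
    factor = solve-∀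

  trivial : ∀ {u} → (L₁ ∩ Ker (δ 2)) u → ∀ i → u i ≡ 0ℤ
  trivial {u} ((_ , σ≡0) , ε₂≡0) = λ where
      zero       → x≡0
      (suc zero) → y≡0
    where
    y≡0 : u (suc zero) ≡ 0ℤ
    y≡0 = trans (sym (pair-δ u (suc zero))) ε₂≡0

    x≡0 : u zero ≡ 0ℤ
    x≡0 = trans (solve-x (u zero) (u (suc zero)))
      (cong₂ _-_ (trans (sym (pair-dim-2 one u)) σ≡0) y≡0)
      where
      solve-x : ∀ x y → x ≡ (1ℤ * x + (1ℤ * y + 0ℤ)) - y
      solve-x = solve-∀

lemma2p3 : IsBasis (Π 5) (columns B₅)
    × (∀ (N : ℕ) → 6 ≤ N → IsBasis (Π N) (ℬ N))
lemma2p3 = basis-Π₅ , basis-Π
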